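{- There is a linear-time algorithm that solves the Strong Geodetic Recognition problem (given a graph $G=(V,E)$ and a vertex set $X\subseteq V(G)$, decide whether $X$ is a strong geodetic set of $G$) for block graphs $G$.
   Context: All graphs are finite, simple, undirected and connected. A block graph is a graph in which every biconnected component is a complete subgraph. A shortest path assignment $I(S)$ of a vertex set $S\subseteq V(G)$ consists of exactly one chosen shortest path of $G$ between $u$ and $v$ for each unordered pair of distinct vertices $u,v\in S$. The set $S$ is a strong geodetic set of $G$ if there is a shortest path assignment $I(S)$ such that every vertex of $V(G)\setminus S$ lies on some path of $I(S)$ (for $|S|\ge 2$ this is the same as $\bigcup_{P\in I(S)}V(P)=V(G)$). Linear time means time $\mathcal{O}(|V(G)|+|E(G)|)$. -}

module Defs where

open import Data.Bool using (Bool; true; false; if_then_else_)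
open import Data.Fin as Fin using (Fin; toℕ)
open import Data.Fin.Properties using (_<?_)
open import Data.Fin.Subset using (Subset; _∈_; _∉_; _⊆_; _-_; Nonempty)
open import Data.List using (List; []; _∷_; length; map; filter; concat; take; tabulate; upTo; allFin; cartesianProduct)
open import Data.List.Relation.Unary.All using (All)
open import Data.List.Relation.Unary.Unique.Propositional using (Unique)
import Data.List.Membership.Propositional as List
open import Data.Nat using (ℕ; zero; suc; pred; _+_; _≤_; _≡ᵇ_; _<ᵇ_; NonZero)
open import Data.Product using (Σ; Σ-syntax; ∃-syntax; _×_; _,_; proj₁; proj₂)
open import Data.Sum using (_⊎_)
open import Data.Vec as Vec using ()
open import Function.Bundles using (_⇔_)
open import Level using (0ℓ)
open import Relation.Binary using (Rel; Decidable; Symmetric; Irreflexive)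
open import Relation.Binary.PropositionalEquality using (_≡_; _≢_)
open import Relation.Nullary using (¬_; _×-dec_)

record Graph : Set₁ where
  infix 4 _~_ _~?_
  field
    order    : ℕ
    _~_      : Rel (Fin order) 0ℓ
    _~?_     : Decidable _~_
    ~-sym    : Symmetric _~_
    ~-irrefl : Irreflexive _≡_ _~_

  V : Set
  V = Fin order

  -- Each undirected edge is listed once, smaller endpoint first.
  edges : List (V × V)
  edges = filter (λ (u , v) → (u <? v) ×-dec (u ~? v))
                 (cartesianProduct (allFin order) (allFin order))

  size : ℕ
  size = length edges

module _ (G : Graph) where
  open Graph G

  infixr 5 _∷_

  data Walk : V → V → Set where
    [_] : ∀ v → Walk v v
    _∷_ : ∀ {u v w} → u ~ v → Walk v w → Walk u w

module _ {G : Graph} where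
  open Graph G

  vertices : ∀ {u v} → Walk G u v → List V
  vertices [ v ]           = v ∷ []
  vertices (_∷_ {u} _ p)   = u ∷ vertices p

  steps : ∀ {u v} → Walk G u v → ℕ
  steps [ _ ]   = 0
  steps (_ ∷ p) = suc (steps p)

module _ (G : Graph) where
  open Graph G

  Path : V → V → Set
  Path u v = Σ[ p ∈ Walk G u v ] Unique (vertices p)

  ShortestPath : V → V → Set
  ShortestPath u v =
    Σ[ p ∈ Path u v ] ((q : Path u v) → steps (proj₁ p) ≤ steps (proj₁ q))

  onPath : ∀ {u v} → ShortestPath u v → List V
  onPath p = vertices (proj₁ (proj₁ p))

  -- The graph without vertices does not count as connected.
  Connected : Set
  Connected = NonZero order × (∀ u v → Path u v)

  -- The subgraph induced by S is connected (or empty).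
  InducesConnected : Subset order → Set
  InducesConnected S = ∀ {u v} → u ∈ S → v ∈ S →
    Σ[ p ∈ Path u v ] All (_∈ S) (vertices (proj₁ p))

  -- The subgraph induced by S is non-empty, connected and has no cut vertex;
  -- in particular K₁ and K₂ are biconnected.
  Biconnected : Subset order → Set
  Biconnected S =
    Nonempty S × InducesConnected S × (∀ {x} → x ∈ S → InducesConnected (S - x))

  -- A maximal biconnected subgraph is induced, so its vertex set determines it.
  BiconnectedComponent : Subset order → Set
  BiconnectedComponent S =
    Biconnected S × (∀ {T} → Biconnected T → S ⊆ T → T ⊆ S)

  Complete : Subset order → Set
  Complete S = ∀ {u v} → u ∈ S → v ∈ S → u ≢ v → u ~ v

  BlockGraph : Set
  BlockGraph = ∀ {S} → BiconnectedComponent S → Complete S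

  -- An unordered pair of distinct vertices is represented by its increasing
  -- ordering.
  ShortestPathAssignment : Subset order → Set
  ShortestPathAssignment S =
    ∀ {u v} → u ∈ S → v ∈ S → u Fin.< v → ShortestPath u v

  StrongGeodetic : Subset order → Set
  StrongGeodetic S =
    Σ[ I ∈ ShortestPathAssignment S ]
      (∀ w → w ∉ S →
        ∃[ u ] ∃[ v ] Σ[ u∈S ∈ u ∈ S ] Σ[ v∈S ∈ v ∈ S ] Σ[ u<v ∈ u Fin.< v ]
          w List.∈ onPath (I u∈S v∈S u<v))

  record AdjacencyLists : Set where
    field
      neighbours : V → List V
      unique     : ∀ v → Unique (neighbours v)
      adjacent   : ∀ {v w} → w List.∈ neighbours v ⇔ v ~ w

-- The model of computation is a random-access machine with structured control
-- and unit cost.  Memory consists of registers and arrays of natural numbers; a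
-- program mentions only finitely many of them, by fixed names, while array
-- cells are addressed by computed indices.  The only arithmetic is successor
-- and predecessor, so after t steps no number in memory exceeds the largest
-- input number or program literal by more than t.  In a linear-time run all
-- numbers therefore have O(log n) bits, and charging one unit per operation
-- hides no large-number arithmetic.

infix  10 _⟦_⟧
infix  6 _≐_ _≺_
infix  5 _≔_ _⟦_⟧≔_
infixr 4 _⨾_

data Expr : Set where
  lit     : ℕ → Expr
  reg     : ℕ → Expr
  _⟦_⟧    : ℕ → Expr → Expr
  inc dec : Expr → Expr

data Test : Set where
  _≐_ _≺_ : Expr → Expr → Test

data Program : Set where
  skip          : Program
  _≔_           : ℕ → Expr → Program
  _⟦_⟧≔_        : ℕ → Expr → Expr → Program
  _⨾_           : Program → Program → Program
  if_then_else′_ : Test → Program → Program → Program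
  while_loop_   : Test → Program → Program

record Store : Set where
  constructor store
  field
    register : ℕ → ℕ
    array    : ℕ → ℕ → ℕ

open Store public

_[_↦_] : {A : Set} → (ℕ → A) → ℕ → A → (ℕ → A)
(f [ i ↦ a ]) j = if i ≡ᵇ j then a else f j

setRegister : ℕ → ℕ → Store → Store
setRegister x a s = store (register s [ x ↦ a ]) (array s)

setArray : ℕ → ℕ → ℕ → Store → Store
setArray x i a s = store (register s) (array s [ x ↦ array s x [ i ↦ a ] ])

eval : Store → Expr → ℕ
eval s (lit k)   = k
eval s (reg x)   = register s x
eval s (x ⟦ e ⟧) = array s x (eval s e)
eval s (inc e)   = suc (eval s e)
eval s (dec e)   = pred (eval s e)

test : Store → Test → Bool
test s (e ≐ f) = eval s e ≡ᵇ eval s f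
test s (e ≺ f) = eval s e <ᵇ eval s f

costᴱ : Expr → ℕ
costᴱ (lit _)   = 1
costᴱ (reg _)   = 1
costᴱ (_ ⟦ e ⟧) = suc (costᴱ e)
costᴱ (inc e)   = suc (costᴱ e)
costᴱ (dec e)   = suc (costᴱ e)

costᵀ : Test → ℕ
costᵀ (e ≐ f) = suc (costᴱ e + costᴱ f)
costᵀ (e ≺ f) = suc (costᴱ e + costᴱ f)

infix 3 ⟨_,_⟩⇓[_]_

-- ⟨ P , s ⟩⇓[ t ] s′ : started in s, the program P halts in s′ after t steps.
data ⟨_,_⟩⇓[_]_ : Program → Store → ℕ → Store → Set where
  skip : ∀ {s} → ⟨ skip , s ⟩⇓[ 1 ] s
  assign : ∀ {x e s} →
    ⟨ x ≔ e , s ⟩⇓[ suc (costᴱ e) ] setRegister x (eval s e) s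
  assignArray : ∀ {x e f s} →
    ⟨ x ⟦ e ⟧≔ f , s ⟩⇓[ suc (costᴱ e + costᴱ f) ] setArray x (eval s e) (eval s f) s
  seq : ∀ {P Q s s′ s″ t t′} →
    ⟨ P , s ⟩⇓[ t ] s′ → ⟨ Q , s′ ⟩⇓[ t′ ] s″ →
    ⟨ P ⨾ Q , s ⟩⇓[ t + t′ ] s″
  ifTrue : ∀ {b P Q s s′ t} →
    test s b ≡ true → ⟨ P , s ⟩⇓[ t ] s′ →
    ⟨ if b then P else′ Q , s ⟩⇓[ suc (costᵀ b + t) ] s′
  ifFalse : ∀ {b P Q s s′ t} →
    test s b ≡ false → ⟨ Q , s ⟩⇓[ t ] s′ →
    ⟨ if b then P else′ Q , s ⟩⇓[ suc (costᵀ b + t) ] s′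
  whileTrue : ∀ {b P s s′ s″ t t′} →
    test s b ≡ true → ⟨ P , s ⟩⇓[ t ] s′ → ⟨ while b loop P , s′ ⟩⇓[ t′ ] s″ →
    ⟨ while b loop P , s ⟩⇓[ suc (costᵀ b + t + t′) ] s″
  whileFalse : ∀ {b P s} →
    test s b ≡ false →
    ⟨ while b loop P , s ⟩⇓[ suc (costᵀ b) ] s

-- The answer is read off register 0: 1 for yes and 0 for no.
_Decides_From_Within_ : Program → Set → Store → ℕ → Set
P Decides Q From s Within bound =
  ∃[ t ] ∃[ s′ ] (⟨ P , s ⟩⇓[ t ] s′ × t ≤ bound ×
    (register s′ 0 ≡ 1 × Q ⊎ register s′ 0 ≡ 0 × ¬ Q))

fromList : List ℕ → ℕ → ℕ
fromList []       _       = 0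
fromList (a ∷ _)  zero    = a
fromList (_ ∷ as) (suc i) = fromList as i

-- The neighbours of vertex v occupy the cells of array 1 from offset v
-- (inclusive) to offset v + 1 (exclusive), the offsets being in array 0.
-- Array 2 holds the characteristic vector of the vertex set, and register 0
-- the number of vertices.  All other memory is 0.
encode : (G : Graph) → AdjacencyLists G → Subset (Graph.order G) → Store
encode G A X = store ((λ _ → 0) [ 0 ↦ order ])
                     ((λ _ _ → 0) [ 0 ↦ fromList offsets ]
                                  [ 1 ↦ fromList (map toℕ (concat rows)) ]
                                  [ 2 ↦ fromList (map bit (Vec.toList X)) ])
  where
  open Graph G
  open AdjacencyLists A

  rows : List (List V)
  rows = tabulate neighbours

  offsets : List ℕ
  offsets = map (λ i → length (concat (take i rows))) (upTo (suc order))

  bit : Bool → ℕ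
  bit b = if b then 1 else 0

{-# OPTIONS --safe #-}
-- In a block graph, two neighbours x and y of w that are connected in G − w lie
-- with w on a cycle, hence in one block, and so are equal or adjacent.  Call a
-- walk taut if no vertex on it is equal or adjacent to the one two steps later.
-- A taut walk therefore never returns, and every walk between its ends passes
-- through all of its vertices; in particular it is a geodesic.  Let w ∉ X have
-- two distinct non-adjacent neighbours.  If every vertex outside X has two such
-- neighbours, a taut walk from w through either of them can be prolonged until
-- it hits X, and w lies on every path between the two vertices of X so reached.
-- Conversely, the vertices before and after w on a geodesic are such neighbours.
--
-- So X is strong geodetic iff it contains every vertex whose neighbourhood is a
-- clique.  As {u, w} lies in a single block for each edge u ~ w, the
-- neighbourhood of w is a clique iff it is contained in N[u] for a single
-- neighbour u, and the first one in the list of w is used.  Grouping the tests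
-- by u keeps the total cost linear: N[u] is marked once for each u, and each
-- list is scanned at most once.
module Submission where

open import Defs
open import Data.Bool using (Bool; true; false; not; _∧_; _∨_; if_then_else_)
open import Data.Bool.Properties using (∨-zeroʳ; ∨-identityʳ; ∧-zeroʳ; ∧-identityʳ; ∧-assoc)
open import Data.Fin as Fin using (Fin; toℕ)
import Data.Fin.Properties as Fin
open import Data.Fin.Subset using (Subset; inside; outside; _-_; _⊃_) renaming (_∈_ to _∈ˢ_; _∉_ to _∉ˢ_)
open import Data.Fin.Subset.Induction using (⊃-wellFounded; Acc; acc)
open import Data.Fin.Subset.Properties using (_∈?_; p─q⊆p; x∈p∧x≢y⇒x∈p-y)
open import Data.List as List using (List; []; _∷_; _++_; length; allFin)
open import Data.List.Membership.Propositional using (_∈_; _∉_; find)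
open import Data.List.Membership.Propositional.Properties using (∈-allFin; ∈-∃++; ∈-++⁻; ∈-++⁺ˡ; ∈-++⁺ʳ)
import Data.List.Properties as List
import Data.List.Relation.Binary.Permutation.Propositional.Properties as ↭
open import Data.List.Relation.Binary.Subset.Propositional using (_⊆_)
open import Data.List.Relation.Unary.All as All using (All; []; _∷_)
open import Data.List.Relation.Unary.All.Properties using (¬Any⇒All¬)
open import Data.List.Relation.Unary.AllPairs using ([]; _∷_)
open import Data.List.Relation.Unary.Any as Any using (Any; here; there)
open import Data.List.Relation.Unary.Unique.Propositional using (Unique)
open import Data.List.Relation.Unary.Unique.Propositional.Properties using (allFin⁺)
open import Data.Maybe using (just)
import Data.Maybe.Properties as Maybe
open import Data.Maybe.Properties using (just-injective)
open import Data.Nat as ℕ using (ℕ; zero; suc; _+_; _*_; _≤_; _<_; z≤n; s≤s)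
open import Data.Nat.ListAction using (sum)
open import Data.Nat.ListAction.Properties using (sum-++; sum-↭)
import Data.Nat.Properties as ℕ
open import Algebra.Properties.CommutativeSemigroup ℕ.+-commutativeSemigroup using () renaming (interchange to ℕ-interchange)
open import Data.Nat.Tactic.RingSolver using (solve-∀)
open import Data.Product using (Σ-syntax; ∃-syntax; _×_; _,_; proj₁; proj₂)
open import Data.Sum as Sum using (_⊎_; inj₁; inj₂)
open import Data.Unit using (⊤; tt)
open import Data.Vec as Vec using ()
import Data.Vec.Properties as Vec
open import Function using (case_of_; _∘_; id; _⇔_; mk⇔; Equivalence)
open import Relation.Binary using (tri<; tri≈; tri>)
open import Relation.Binary.Construct.Closure.ReflexiveTransitive as Star using (Star; ε; _◅_; _◅◅_)
open import Relation.Binary.PropositionalEquality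
open import Relation.Nullary using (¬_; Dec; yes; no; does; contradiction; _×-dec_; _⊎-dec_; _→-dec_; ¬?; decidable-stable)
open import Relation.Nullary.Decidable using (does-⇔; dec-true; dec-false)
open import Relation.Unary using (Decidable)

-- Sums and counting over lists.

private variable
  A B : Set

∑ : List A → (A → ℕ) → ℕ
∑ xs f = sum (List.map f xs)

𝟙 : ∀ {P : Set} → Dec P → ℕ
𝟙 P? = if does P? then 1 else 0

∑-mono : ∀ {f g : A → ℕ} → (∀ x → f x ≤ g x) → ∀ xs → ∑ xs f ≤ ∑ xs g
∑-mono f≤g []       = z≤n
∑-mono f≤g (x ∷ xs) = ℕ.+-mono-≤ (f≤g x) (∑-mono f≤g xs)

∑-+ : ∀ (f g : A → ℕ) xs → ∑ xs (λ x → f x + g x) ≡ ∑ xs f + ∑ xs g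
∑-+ f g []       = refl
∑-+ f g (x ∷ xs) = trans (cong (f x + g x +_) (∑-+ f g xs))
  (ℕ-interchange (f x) (g x) (∑ xs f) (∑ xs g))

∑-* : ∀ k (f : A → ℕ) xs → ∑ xs (λ x → k * f x) ≡ k * ∑ xs f
∑-* k f []       = sym (ℕ.*-zeroʳ k)
∑-* k f (x ∷ xs) = trans (cong (k * f x +_) (∑-* k f xs)) (sym (ℕ.*-distribˡ-+ k (f x) _))

∑-const : ∀ k (xs : List A) → ∑ xs (λ _ → k) ≡ length xs * k
∑-const k []       = refl
∑-const k (x ∷ xs) = cong (k +_) (∑-const k xs)

∑-++ : ∀ (f : A → ℕ) xs ys → ∑ (xs ++ ys) f ≡ ∑ xs f + ∑ ys f
∑-++ f xs ys = trans (cong sum (List.map-++ f xs ys)) (sum-++ (List.map f xs) _)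

∑-swap : ∀ (f : A → B → ℕ) xs ys →
  ∑ xs (λ x → ∑ ys (f x)) ≡ ∑ ys (λ y → ∑ xs (λ x → f x y))
∑-swap f []       ys = sym (trans (∑-const 0 ys) (ℕ.*-zeroʳ (length ys)))
∑-swap f (x ∷ xs) ys = trans (cong (∑ ys (f x) +_) (∑-swap f xs ys)) (sym (∑-+ (f x) _ ys))

-- The head of `xs` is permuted to the front of `ys` and removed there; by uniqueness the other
-- entries of `xs` survive this removal.
∑-unique-⊆ : ∀ (f : A → ℕ) {xs ys} → Unique xs → xs ⊆ ys → ∑ xs f ≤ ∑ ys f
∑-unique-⊆ f []                 _     = z≤n
∑-unique-⊆ f {x ∷ xs} (x∉xs ∷ xs!) xs⊆ys with ∈-∃++ (xs⊆ys (here refl))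
... | as , bs , refl = begin
  f x + ∑ xs f                ≤⟨ ℕ.+-monoʳ-≤ (f x) (∑-unique-⊆ f xs! without-x) ⟩
  f x + ∑ (as ++ bs) f        ≡⟨ sum-↭ (↭.map⁺ f (↭.shift x as bs)) ⟨
  ∑ (as ++ x ∷ bs) f          ∎
  where
  open ℕ.≤-Reasoning
  without-x : xs ⊆ as ++ bs
  without-x y∈xs with ∈-++⁻ as (xs⊆ys (there y∈xs))
  ... | inj₁ y∈as         = ∈-++⁺ˡ y∈as
  ... | inj₂ (here refl)  = contradiction refl (All.lookup x∉xs y∈xs)
  ... | inj₂ (there y∈bs) = ∈-++⁺ʳ as y∈bs

length-filter : ∀ {P : A → Set} (P? : Decidable P) xs →
  length (List.filter P? xs) ≡ ∑ xs (𝟙 ∘ P?)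
length-filter P? [] = refl
length-filter P? (x ∷ xs) with does (P? x)
... | true  = cong suc (length-filter P? xs)
... | false = length-filter P? xs

∑-cartesianProduct : ∀ (f : A × B → ℕ) xs ys →
  ∑ (List.cartesianProduct xs ys) f ≡ ∑ xs (λ x → ∑ ys (λ y → f (x , y)))
∑-cartesianProduct f []       ys = refl
∑-cartesianProduct f (x ∷ xs) ys = trans (∑-++ f (List.map (x ,_) ys) _)
  (cong₂ _+_ (cong sum (sym (List.map-∘ ys))) (∑-cartesianProduct f xs ys))

length-∑ : (xs : List A) → length xs ≡ ∑ xs (λ _ → 1)
length-∑ xs = sym (trans (∑-const 1 xs) (ℕ.*-identityʳ _))

unique-length-⊆ : {xs ys : List A} → Unique xs → xs ⊆ ys → length xs ≤ length ys
unique-length-⊆ {xs = xs} {ys} xs! xs⊆ys =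
  subst₂ _≤_ (sym (length-∑ xs)) (sym (length-∑ ys)) (∑-unique-⊆ (λ _ → 1) xs! xs⊆ys)

unique-length : ∀ {n} {xs : List (Fin n)} → Unique xs → length xs ≤ n
unique-length {n} {xs} xs! = subst (length xs ≤_) (List.length-tabulate id)
  (unique-length-⊆ xs! λ _ → ∈-allFin _)

-- Degree sums and charging along adjacency lists.

module _ {G : Graph} (A : AdjacencyLists G) where
  open Graph G
  open AdjacencyLists A

  First : V → V → Set
  First u w = List.head (neighbours w) ≡ just u

  first? : ∀ u w → Dec (First u w)
  first? u w = Maybe.≡-dec Fin._≟_ (List.head (neighbours w)) (just u)

  -- Each entry of an adjacency list is an edge listed in one of its two orientations, and summing
  -- `up` over all ordered pairs gives `size`.
  handshake : ∑ (allFin order) (length ∘ neighbours) ≤ size + size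
  handshake = begin
    ∑ vs (length ∘ neighbours)                           ≤⟨ ∑-mono degree≤ vs ⟩
    ∑ vs (λ v → ∑ vs (λ w → up v w + up w v))            ≡⟨ cong sum (List.map-cong (λ v → ∑-+ (up v) (λ w → up w v) vs) vs) ⟩
    ∑ vs (λ v → ∑ vs (up v) + ∑ vs (λ w → up w v))       ≡⟨ ∑-+ _ _ vs ⟩
    ∑∑up + ∑ vs (λ v → ∑ vs (λ w → up w v))              ≡⟨ cong (∑∑up +_) (∑-swap up vs vs) ⟨
    ∑∑up + ∑∑up                                          ≡⟨ cong₂ _+_ size≡ size≡ ⟨
    size + size                                          ∎
    where
    open ℕ.≤-Reasoning
    vs : List V
    vs = allFin order

    up : V → V → ℕ
    up v w = 𝟙 (v Fin.<? w ×-dec v ~? w)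

    ∑∑up : ℕ
    ∑∑up = ∑ vs λ v → ∑ vs (up v)

    size≡ : size ≡ ∑∑up
    size≡ = trans (length-filter _ (List.cartesianProduct vs vs)) (∑-cartesianProduct _ vs vs)

    up-one : ∀ {v w} → v Fin.< w → v ~ w → up v w ≡ 1
    up-one v<w v~w = cong (if_then 1 else 0) (dec-true (_ Fin.<? _ ×-dec _ ~? _) (v<w , v~w))

    1≤up : ∀ {v w} → v ~ w → 1 ≤ up v w + up w v
    1≤up {v} {w} v~w with Fin.<-cmp v w
    ... | tri< v<w _ _ = ℕ.≤-trans (ℕ.≤-reflexive (sym (up-one v<w v~w))) (ℕ.m≤m+n _ _)
    ... | tri≈ _ v≡w _ = contradiction v~w (~-irrefl v≡w)
    ... | tri> _ _ w<v = ℕ.≤-trans (ℕ.≤-reflexive (sym (up-one w<v (~-sym v~w)))) (ℕ.m≤n+m _ _)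

    length≤∑ : ∀ {v} ws → All (v ~_) ws → length ws ≤ ∑ ws (λ w → up v w + up w v)
    length≤∑ []       []           = z≤n
    length≤∑ (w ∷ ws) (v~w ∷ v~ws) = ℕ.+-mono-≤ (1≤up v~w) (length≤∑ ws v~ws)

    degree≤ : ∀ v → length (neighbours v) ≤ ∑ vs (λ w → up v w + up w v)
    degree≤ v = ℕ.≤-trans
      (length≤∑ (neighbours v) (All.tabulate (Equivalence.to adjacent)))
      (∑-unique-⊆ _ (unique v) λ _ → ∈-allFin _)

  -- Every vertex w is charged once, at its first neighbour.
  ∑-first≤ : ∀ (c : V → ℕ) →
    ∑ (allFin order) (λ u → ∑ (neighbours u) (λ w → if does (first? u w) then c w else 0))
      ≤ ∑ (allFin order) c
  ∑-first≤ c = begin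
    ∑ vs (λ u → ∑ (neighbours u) (charge u))  ≤⟨ ∑-mono (λ u → ∑-unique-⊆ (charge u) (unique u) λ _ → ∈-allFin _) vs ⟩
    ∑ vs (λ u → ∑ vs (charge u))              ≡⟨ ∑-swap charge vs vs ⟩
    ∑ vs (λ w → ∑ vs (λ u → charge u w))      ≤⟨ ∑-mono (λ w → once w vs (allFin⁺ order)) vs ⟩
    ∑ vs c                                    ∎
    where
    open ℕ.≤-Reasoning
    vs : List V
    vs = allFin order

    charge : V → V → ℕ
    charge u w = if does (first? u w) then c w else 0

    never : ∀ {u} w us → First u w → All (u ≢_) us → ∑ us (λ u → charge u w) ≡ 0
    never w []        _ _ = refl
    never w (u′ ∷ us) f (u≢u′ ∷ u∉us) with first? u′ w
    ... | yes f′ = contradiction (just-injective (trans (sym f) f′)) u≢u′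
    ... | no _  = never w us f u∉us

    once : ∀ w us → Unique us → ∑ us (λ u → charge u w) ≤ c w
    once w []       _ = z≤n
    once w (u ∷ us) (u∉us ∷ us!) with first? u w
    ... | yes f = ℕ.≤-reflexive (trans (cong (c w +_) (never w us f u∉us)) (ℕ.+-identityʳ _))
    ... | no _  = once w us us!

-- Subsets given by lists, and small index sets.

x∉p-x : ∀ {n} (x : Fin n) (p : Subset n) → x ∉ˢ p - x
x∉p-x Fin.zero    (_ Vec.∷ _) ()
x∉p-x (Fin.suc x) (_ Vec.∷ p) (Vec.there x∈p-x) = x∉p-x x p x∈p-x

module _ {n : ℕ} where

  fromElements : List (Fin n) → Subset n
  fromElements xs = Vec.tabulate λ x → does (Any.any? (x Fin.≟_) xs)

  ∈-fromElements⁺ : ∀ {x} xs → x ∈ xs → x ∈ˢ fromElements xs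
  ∈-fromElements⁺ {x} xs x∈xs = Vec.lookup⇒[]= x (fromElements xs)
    (trans (Vec.lookup∘tabulate _ x) (dec-true (Any.any? (x Fin.≟_) xs) x∈xs))

  ∈-fromElements⁻ : ∀ {x} xs → x ∈ˢ fromElements xs → x ∈ xs
  ∈-fromElements⁻ {x} xs x∈
    with Any.any? (x Fin.≟_) xs | trans (sym (Vec.lookup∘tabulate _ x)) (Vec.[]=⇒lookup x∈)
  ... | yes x∈xs | _ = x∈xs

single-element : ∀ {n} → n ≡ 1 → (i j : Fin n) → i ≡ j
single-element refl Fin.zero Fin.zero = refl

other-element : ∀ {n} → n ≢ 1 → (i : Fin n) → ∃[ j ] i ≢ j
other-element {suc zero}    n≢1 _            = contradiction refl n≢1
other-element {suc (suc n)} _   Fin.zero    = Fin.suc Fin.zero , λ ()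
other-element {suc (suc n)} _   (Fin.suc _) = Fin.zero , λ ()

-- Walks, loop erasure and walks confined to a vertex set.

module _ {G : Graph} where
  open Graph G

  private variable
    P Q : V → Set
    a b u v w x y z : V

  Close : V → V → Set
  Close u v = u ≡ v ⊎ u ~ v

  close? : ∀ u v → Dec (Close u v)
  close? u v = u Fin.≟ v ⊎-dec u ~? v

  close-sym : Close u v → Close v u
  close-sym (inj₁ refl) = inj₁ refl
  close-sym (inj₂ u~v)  = inj₂ (~-sym u~v)

  start∈ : (p : Walk G u v) → u ∈ vertices p
  start∈ [ _ ]   = here refl
  start∈ (_ ∷ _) = here refl

  end∈ : (p : Walk G u v) → v ∈ vertices p
  end∈ [ _ ]   = here refl
  end∈ (_ ∷ p) = there (end∈ p)

  length-vertices : (p : Walk G u v) → length (vertices p) ≡ suc (steps p)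
  length-vertices [ _ ]   = refl
  length-vertices (_ ∷ p) = cong suc (length-vertices p)

  drop-until : (p : Walk G u v) → w ∈ vertices p → Unique (vertices p) →
    Σ[ q ∈ Path G w v ] vertices (proj₁ q) ⊆ vertices p × steps (proj₁ q) ≤ steps p
  drop-until [ _ ]   (here refl) p! = ([ _ ] , p!) , id , ℕ.≤-refl
  drop-until (e ∷ p) (here refl) p! = (e ∷ p , p!) , id , ℕ.≤-refl
  drop-until (e ∷ p) (there w∈p) (_ ∷ p!) with drop-until p w∈p p!
  ... | q , q⊆p , q≤p = q , there ∘ q⊆p , ℕ.m≤n⇒m≤1+n q≤p

  -- Lets walks be built freely although connectivity and geodesics are stated for paths. If the new
  -- start already lies on the erased tail, the tail is cut there.
  erase-loops : (p : Walk G u v) →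
    Σ[ q ∈ Path G u v ] vertices (proj₁ q) ⊆ vertices p × steps (proj₁ q) ≤ steps p
  erase-loops [ _ ] = ([ _ ] , [] ∷ []) , id , z≤n
  erase-loops (_∷_ {u = u} e p) with erase-loops p
  ... | (q , q!) , q⊆p , q≤p with Any.any? (u Fin.≟_) (vertices q)
  ...   | yes u∈q = let r , r⊆q , r≤q = drop-until q u∈q q! in
          r , there ∘ q⊆p ∘ r⊆q , ℕ.m≤n⇒m≤1+n (ℕ.≤-trans r≤q q≤p)
  ...   | no u∉q = (e ∷ q , ¬Any⇒All¬ _ u∉q ∷ q!)
          , (λ { (here x≡u) → here x≡u ; (there x∈q) → there (q⊆p x∈q) }) , s≤s q≤p

  -- The empty walk says nothing about its vertex, whence the premise `P u` in `within-path`.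
  Within : (V → Set) → V → V → Set
  Within P = Star (λ u v → P u × P v × u ~ v)

  Avoiding : V → V → V → Set
  Avoiding w = Within (w ≢_)

  within-sym : Within P u v → Within P v u
  within-sym = Star.reverse (λ (Pu , Pv , u~v) → Pv , Pu , ~-sym u~v)

  within-path : P u → Within P u v → Σ[ p ∈ Path G u v ] All P (vertices (proj₁ p))
  within-path Pu walk =
    let p , P-p = go Pu walk ; q , q⊆p , _ = erase-loops p in
    q , All.tabulate (All.lookup P-p ∘ q⊆p)
    where
    go : P u → Within P u v → Σ[ p ∈ Walk G u v ] All P (vertices p)
    go Pu ε = [ _ ] , Pu ∷ []
    go _ ((Pu , Pv , u~v) ◅ walk) = let p , P-p = go Pv walk in u~v ∷ p , Pu ∷ P-p

  prefix : (p : Walk G u v) → All P (vertices p) → z ∈ vertices p → Within P u z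
  prefix [ _ ]   _          (here refl) = ε
  prefix (e ∷ p) _          (here refl) = ε
  prefix (e ∷ p) (Pu ∷ P-p) (there z∈p) = (Pu , All.lookup P-p (start∈ p) , e) ◅ prefix p P-p z∈p

  suffix : (p : Walk G u v) → All P (vertices p) → z ∈ vertices p → Within P z v
  suffix [ _ ]   _          (here refl) = ε
  suffix (e ∷ p) P-p        (here refl) = prefix (e ∷ p) P-p (end∈ (e ∷ p))
  suffix (e ∷ p) (_ ∷ P-p)  (there z∈p) = suffix p P-p z∈p

  -- A path meets `z` at most once, so the stretch before `w` or the stretch after it is free of
  -- `z`.
  reach-an-end : (p : Walk G u v) → Unique (vertices p) →
    (∀ {x} → x ∈ vertices p → x ≢ z → P x) →
    w ∈ vertices p → w ≢ z → Within P u w ⊎ Within P w v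
  reach-an-end [ _ ]   _ _ (here refl) _ = inj₁ ε
  reach-an-end (e ∷ p) _ _ (here refl) _ = inj₁ ε
  reach-an-end {z = z} (_∷_ {u = u} e p) (u∉p ∷ p!) f (there w∈p) w≢z
    with u Fin.≟ z
  ... | yes refl = inj₂ (suffix p (All.tabulate λ x∈p → f (there x∈p)
          (λ { refl → All.lookup u∉p x∈p refl })) w∈p)
  ... | no u≢z with reach-an-end p p! (f ∘ there) w∈p w≢z
  ...   | inj₂ walk = inj₂ walk
  ...   | inj₁ ε = inj₁ ((f (here refl) u≢z , f (there w∈p) w≢z , e) ◅ ε)
  ...   | inj₁ walk@((Py , _) ◅ _) = inj₁ ((f (here refl) u≢z , Py , e) ◅ walk)

  -- Cycles are biconnected.

  hub-connected : {S : Subset order} →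
    (∀ {v} → v ∈ˢ S → Within (_∈ˢ S) v w) → InducesConnected G S
  hub-connected to-hub u∈S v∈S = within-path u∈S (to-hub u∈S ◅◅ within-sym (to-hub v∈S))

  -- Without `w` the path itself remains. Without a vertex `z` of the path, every other vertex of it
  -- still reaches `x` or `y` along the path, and from there `w`.
  cycle-biconnected : (p : Path G x y) → w ~ x → w ~ y → All (w ≢_) (vertices (proj₁ p)) →
    Biconnected G (fromElements (w ∷ vertices (proj₁ p)))
  cycle-biconnected {x} {y} {w} (p , p!) w~x w~y w∉p =
    (w , ∈S (here refl)) , hub-connected (to-w ∘ ∈-fromElements⁻ _) , λ {z} _ → remove z
    where
    cycle : List V
    cycle = w ∷ vertices p

    S : Subset order
    S = fromElements cycle

    ∈S : z ∈ (w ∷ vertices p) → z ∈ˢ S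
    ∈S = ∈-fromElements⁺ _

    to-w : v ∈ (w ∷ vertices p) → Within (_∈ˢ S) v w
    to-w (here refl) = ε
    to-w (there v∈p) = within-sym
      ((∈S (here refl) , ∈S (there (start∈ p)) , w~x)
        ◅ prefix p (All.tabulate (∈S ∘ there)) v∈p)

    remove : ∀ z → InducesConnected G (S - z)
    remove z with w Fin.≟ z
    ... | yes refl = hub-connected λ v∈ → within-sym (prefix p all∈ (remaining v∈))
      where
      all∈ : All (_∈ˢ S - w) (vertices p)
      all∈ = All.tabulate λ z∈p →
        x∈p∧x≢y⇒x∈p-y (∈S (there z∈p)) (All.lookup w∉p z∈p ∘ sym)
      remaining : v ∈ˢ S - w → v ∈ vertices p
      remaining v∈ with ∈-fromElements⁻ cycle (p─q⊆p S _ v∈)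
      ... | here refl = contradiction v∈ (x∉p-x _ S)
      ... | there v∈p = v∈p
    ... | no w≢z = hub-connected λ v∈ →
          go (λ { refl → x∉p-x _ S v∈ }) (∈-fromElements⁻ cycle (p─q⊆p S _ v∈))
      where
      stays : ∀ {t} → t ∈ (w ∷ vertices p) → t ≢ z → t ∈ˢ S - z
      stays t∈ t≢z = x∈p∧x≢y⇒x∈p-y (∈S t∈) t≢z

      extend : Within (_∈ˢ S - z) u v → u ∈ vertices p → u ≢ z → w ~ u → Within (_∈ˢ S - z) v w
      extend walk u∈p u≢z w~u =
        within-sym ((stays (here refl) w≢z , stays (there u∈p) u≢z , w~u) ◅ walk)

      source≢ : Within (_∈ˢ S - z) u v → v ≢ z → u ≢ z
      source≢ ε                v≢z = v≢z
      source≢ ((u∈ , _) ◅ _) _ refl = x∉p-x _ S u∈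

      go : v ≢ z → v ∈ (w ∷ vertices p) → Within (_∈ˢ S - z) v w
      go v≢z (here refl) = ε
      go v≢z (there v∈p) with reach-an-end p p! (stays ∘ there) v∈p v≢z
      ... | inj₁ walk = extend walk (start∈ p) (source≢ walk v≢z) w~x
      ... | inj₂ walk = extend (within-sym walk) (end∈ p) (source≢ (within-sym walk) v≢z) w~y

  -- Taut walks and interior vertices of geodesics.

  Taut : Walk G u v → Set
  Taut [ _ ]                                = ⊤
  Taut (_ ∷ [ _ ])                          = ⊤
  Taut (_∷_ {u = x} _ p@(_∷_ {v = z} _ _)) = ¬ Close x z × Taut p

  taut-tail : (e : x ~ y) (p : Walk G y z) → Taut (e ∷ p) → Taut p
  taut-tail e [ _ ]   _       = tt
  taut-tail e (_ ∷ p) (_ , t) = t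

  -- Built from the far end: a new vertex close to the one two steps ahead is merged with it or
  -- joined to it directly, and the comparison is repeated on the shorter rest.
  tauten : Walk G u v → Σ[ p ∈ Walk G u v ] Taut p
  tauten [ _ ] = [ _ ] , tt
  tauten (e ∷ p) = let q , t = tauten p in prepend e q t
    where
    prepend : x ~ y → (p : Walk G y z) → Taut p → Σ[ q ∈ Walk G x z ] Taut q
    prepend e [ _ ] _ = e ∷ [ _ ] , tt
    prepend {x} e p@(_∷_ {v = z} e′ q) t with close? x z
    ... | no x≁z = e ∷ p , x≁z , t
    ... | yes (inj₁ refl) = q , taut-tail e′ q t
    ... | yes (inj₂ x~z)  = prepend x~z q (taut-tail e′ q t)

  -- Says that `w` is not simplicial.
  Branching : V → Set
  Branching w = ∃[ x ] ∃[ y ] w ~ x × w ~ y × ¬ Close x y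

  close-avoiding : w ~ x → w ~ y → Close x y → Avoiding w x y
  close-avoiding _   _   (inj₁ refl) = ε
  close-avoiding w~x w~y (inj₂ x~y)  =
    ((λ w≡x → ~-irrefl w≡x w~x) , (λ w≡y → ~-irrefl w≡y w~y) , x~y) ◅ ε

  -- The witnesses are the vertices just before and just after `w`; if they are equal or adjacent,
  -- skipping `w` saves two steps or one.
  interior-shortcut : (p : Walk G a b) → w ∈ vertices p → a ≢ w → w ≢ b →
    ∃[ x ] ∃[ y ] w ~ x × w ~ y × (Close x y → Σ[ q ∈ Walk G a b ] steps q < steps p)
  interior-shortcut [ _ ]         (here refl)         a≢w _ = contradiction refl a≢w
  interior-shortcut (_ ∷ _)       (here refl)         a≢w _ = contradiction refl a≢w
  interior-shortcut (_ ∷ [ _ ])   (there (here refl)) _ w≢b = contradiction refl w≢b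
  interior-shortcut {w = w} (e ∷ p@(_∷_ {u = y} e′ q)) (there w∈p) a≢w w≢b with y Fin.≟ w
  ... | yes refl = _ , _ , ~-sym e , e′ , λ
    { (inj₁ refl) → q , ℕ.m≤n+m _ 1
    ; (inj₂ a~z)  → a~z ∷ q , ℕ.≤-refl }
  ... | no y≢w with interior-shortcut p w∈p y≢w w≢b
  ...   | x , z , w~x , w~z , shortcut = x , z , w~x , w~z , λ c →
          let r , r<p = shortcut c in e ∷ r , s≤s r<p

  -- The ends of the path covering `w` are in `X`, so `w` is interior to it; a shortcut past `w`
  -- would, after loop erasure, beat a shortest path.
  strong⇒branching : ∀ {X} → StrongGeodetic G X → w ∉ˢ X → Branching w
  strong⇒branching {w} (I , covers) w∉X with covers w w∉X
  ... | a , b , a∈X , b∈X , a<b , w∈p with I a∈X b∈X a<b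
  ...   | (p , _) , shortest
    with interior-shortcut p w∈p (λ { refl → w∉X a∈X }) (λ { refl → w∉X b∈X })
  ...     | x , y , w~x , w~y , shortcut = x , y , w~x , w~y , λ c →
            let q , q<p = shortcut c ; r , _ , r≤q = erase-loops q in
            ℕ.<⇒≱ q<p (ℕ.≤-trans (shortest r) r≤q)

  bypass : (p : ShortestPath G a b) → w ∉ onPath G p → Avoiding w a b
  bypass ((p , _) , _) w∉p = prefix p (¬Any⇒All¬ _ w∉p) (end∈ p)

  -- Block graphs: taut walks are geodesics and can be prolonged into `X`.

  module _ (block : BlockGraph G) where

    -- Extends the block property from maximal biconnected sets to all of them without constructing
    -- a component: if `u` and `v` were not adjacent, then by induction no larger set would be
    -- biconnected, so `S` would itself be maximal and hence complete.
    biconnected-complete : ∀ {S} → Acc _⊃_ S → Biconnected G S → Complete G S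
    biconnected-complete {S} (acc larger) bi {u} {v} u∈S v∈S u≢v =
      decidable-stable (u ~? v) λ u≁v → u≁v (block (bi , λ {T} bi-T S⊆T {x} x∈T →
        decidable-stable (x ∈? S) λ x∉S →
          u≁v (biconnected-complete (larger (S⊆T , x , x∈T , x∉S)) bi-T (S⊆T u∈S) (S⊆T v∈S) u≢v))
        u∈S v∈S u≢v)

    -- All later use of the block property goes through this lemma; the loop-erased walk closes up
    -- to a cycle through `w`.
    neighbours-cut : w ~ x → w ~ y → Avoiding w x y → Close x y
    neighbours-cut {w} {x} {y} w~x w~y walk with x Fin.≟ y
    ... | yes x≡y = inj₁ x≡y
    ... | no x≢y =
      let p , w∉p = within-path (λ w≡x → ~-irrefl w≡x w~x) walk in
      inj₂ (biconnected-complete (⊃-wellFounded _) (cycle-biconnected p w~x w~y w∉p)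
        (∈-fromElements⁺ _ (there (start∈ (proj₁ p)))) (∈-fromElements⁺ _ (there (end∈ (proj₁ p)))) x≢y)

    -- If the start `x` recurred, the rest of the walk would lead from `z` back to `x` without
    -- meeting `y` again. As both are neighbours of `y`, they would be close, against tautness.
    taut-unique : (p : Walk G u v) → Taut p → Unique (vertices p)
    taut-unique [ _ ] _ = [] ∷ []
    taut-unique (e ∷ [ _ ]) _ = ((λ u≡v → ~-irrefl u≡v e) ∷ []) ∷ [] ∷ []
    taut-unique (_∷_ {u = x} e p@(_∷_ {u = y} e′ q)) (x≁z , t) with taut-unique p t
    ... | p! @ (y∉q ∷ _) = ((λ x≡y → ~-irrefl x≡y e) ∷ All.tabulate λ { w∈q refl →
          x≁z (close-sym (neighbours-cut e′ (~-sym e) (prefix q y∉q w∈q))) }) ∷ p!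

    -- Induction with `q` extended backwards by the first edge leaves only the second vertex `y` in
    -- doubt. If `q` missed it, `q` and the rest of `p` would join the two neighbours of `y` on the
    -- taut walk without using `y`.
    taut-unavoidable : (p : Walk G u v) → Taut p → (q : Walk G u v) → vertices p ⊆ vertices q
    taut-unavoidable [ _ ]   _ q (here refl) = start∈ q
    taut-unavoidable (e ∷ p) _ q (here refl) = start∈ q
    taut-unavoidable (e ∷ p) t q (there w∈p)
      with taut-unavoidable p (taut-tail e p t) (~-sym e ∷ q) w∈p
    ... | there w∈q = w∈q
    ... | here refl = second p t
      where
      second : (p : Walk G _ _) → Taut (e ∷ p) → _ ∈ vertices q
      second [ _ ] _ = end∈ q
      second p@(_∷_ {u = y} e′ r) (x≁z , t) with taut-unique p t
      ... | y∉r ∷ _ = decidable-stable (Any.any? (y Fin.≟_) (vertices q)) λ y∉q →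
        x≁z (neighbours-cut (~-sym e) e′ (prefix q (¬Any⇒All¬ _ y∉q) (end∈ q)
          ◅◅ within-sym (prefix r y∉r (end∈ r))))

    -- The vertices of a taut walk are distinct and lie on every competitor, so comparing vertex
    -- counts suffices.
    shortest-path : Connected G → ∀ u v → ShortestPath G u v
    shortest-path (_ , path) u v with tauten (proj₁ (path u v))
    ... | p , t = (p , taut-unique p t) , λ (q , _) → ℕ.≤-pred (begin
      suc (steps p)        ≡⟨ length-vertices p ⟨
      length (vertices p)  ≤⟨ unique-length-⊆ (taut-unique p t) (taut-unavoidable p t q) ⟩
      length (vertices q)  ≡⟨ length-vertices q ⟩
      suc (steps q)        ∎)
      where open ℕ.≤-Reasoning

    module _ {X : Subset order} (branching : ∀ w → w ∉ˢ X → Branching w) where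

      -- If both branches at `a` were close to `y`, they would be joined through `y` in the graph
      -- without `a`, hence close to each other.
      outward : a ∉ˢ X → a ~ y → ∃[ z ] a ~ z × ¬ Close z y
      outward {a} {y} a∉X a~y with branching a a∉X
      ... | f , g , a~f , a~g , f≁g with close? f y | close? g y
      ...   | no f≁y  | _       = f , a~f , f≁y
      ...   | yes _   | no g≁y  = g , a~g , g≁y
      ...   | yes f≈y | yes g≈y = contradiction (neighbours-cut a~f a~g
                (close-avoiding a~f a~y f≈y ◅◅ close-avoiding a~y a~g (close-sym g≈y))) f≁g

      -- The walk is prolonged at its front `a`, away from `w`. Being free of repetitions it has at
      -- most `order` vertices, so the fuel `k` cannot run out before `X` is met.
      grow : ∀ k (e : a ~ y) (p : Walk G y w) → Taut (e ∷ p) → Avoiding w a x →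
        order < length (vertices (e ∷ p)) + k → ∃[ b ] b ∈ˢ X × Avoiding w b x
      grow zero e p t _ long = contradiction (unique-length (taut-unique (e ∷ p) t))
        (ℕ.<⇒≱ (subst (order <_) (ℕ.+-identityʳ _) long))
      grow {a} (suc k) e p t walk long with a ∈? X
      ... | yes a∈X = a , a∈X , walk
      ... | no a∉X with outward a∉X e
      ...   | z , a~z , z≁y with taut-unique (~-sym a~z ∷ e ∷ p) (z≁y , t)
      ...     | (_ ∷ z∉p) ∷ (a∉p ∷ _) = grow k (~-sym a~z) (e ∷ p) (z≁y , t)
                ((≢-sym (All.lookup z∉p (end∈ p)) , ≢-sym (All.lookup a∉p (end∈ p)) , ~-sym a~z) ◅ walk)
                (subst (order <_) (ℕ.+-suc _ k) long)

      arm : w ~ x → ∃[ b ] b ∈ˢ X × Avoiding w b x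
      arm w~x = grow order (~-sym w~x) [ _ ] tt ε (ℕ.m<n+m order (s≤s z≤n))

      -- Two arms leave `w` through non-close neighbours. If their ends coincided, or were joined by
      -- a path missing `w`, these neighbours would be connected without `w` and hence close.
      branching⇒strong : Connected G → StrongGeodetic G X
      branching⇒strong connected = (λ {u} {v} _ _ _ → shortest-path connected u v) , covers
        where
        covers : ∀ w → w ∉ˢ X → ∃[ u ] ∃[ v ] Σ[ u∈X ∈ u ∈ˢ X ] Σ[ v∈X ∈ v ∈ˢ X ] Σ[ u<v ∈ u Fin.< v ]
          w ∈ onPath G (shortest-path connected u v)
        covers w w∉X with branching w w∉X
        ... | x , y , w~x , w~y , x≁y with arm w~x | arm w~y
        ...   | a , a∈X , a⇝x | b , b∈X , b⇝y with Fin.<-cmp a b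
        ...     | tri≈ _ refl _ = contradiction (neighbours-cut w~x w~y (within-sym a⇝x ◅◅ b⇝y)) x≁y
        ...     | tri< a<b _ _  = a , b , a∈X , b∈X , a<b , decidable-stable (Any.any? (w Fin.≟_) _) λ w∉p →
                    x≁y (neighbours-cut w~x w~y (within-sym a⇝x ◅◅ bypass (shortest-path connected a b) w∉p ◅◅ b⇝y))
        ...     | tri> _ _ b<a  = b , a , b∈X , a∈X , b<a , decidable-stable (Any.any? (w Fin.≟_) _) λ w∉p →
                    x≁y (neighbours-cut w~x w~y (within-sym a⇝x ◅◅ within-sym (bypass (shortest-path connected b a) w∉p) ◅◅ b⇝y))

  -- The criterion checked by the algorithm.

  module _ (A : AdjacencyLists G) where
    open AdjacencyLists A

    Escapes : V → V → Set
    Escapes u w = Any (λ x → ¬ Close u x) (neighbours w)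

    escapes? : ∀ u w → Dec (Escapes u w)
    escapes? u w = Any.any? (λ x → ¬? (close? u x)) (neighbours w)

    escapes⇒branching : ∀ {u w} → w ~ u → Escapes u w → Branching w
    escapes⇒branching w~u escapes with find escapes
    ... | x , x∈ , u≁x = _ , x , w~u , Equivalence.to adjacent x∈ , u≁x

    module _ (block : BlockGraph G) where

      -- If every neighbour of `w` were close to `u`, then `x` and `y` would be joined through `u`
      -- without `w`, hence close.
      branching⇒escapes : ∀ {u w} → w ~ u → Branching w → Escapes u w
      branching⇒escapes {u} {w} w~u (x , y , w~x , w~y , x≁y) = decidable-stable (escapes? u w) λ ¬escapes →
        let close : ∀ {z} → w ~ z → Close u z
            close = λ {z} w~z → decidable-stable (close? u z) λ u≁z →
              ¬escapes (Any.map (λ { refl → u≁z }) (Equivalence.from adjacent w~z))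
        in x≁y (neighbours-cut block w~x w~y
             (close-avoiding w~x w~u (close-sym (close w~x)) ◅◅ close-avoiding w~u w~y (close w~y)))

    module _ (X : Subset order) where

      -- Vacuous unless `u` heads the list of `w`, so that each vertex is tested against one
      -- neighbour only.
      Passes : V → V → Set
      Passes u w = First A u w → w ∈ˢ X ⊎ Escapes u w

      passes? : ∀ u w → Dec (Passes u w)
      passes? u w = first? A u w →-dec (w ∈? X ⊎-dec escapes? u w)

      AllPass : Set
      AllPass = All (λ u → All (Passes u) (neighbours u)) (allFin order)

      allPass? : Dec AllPass
      allPass? = All.all? (λ u → All.all? (passes? u) (neighbours u)) (allFin order)

      module _ (connected : Connected G) where

        first-vertex : V
        first-vertex = Fin.fromℕ< (ℕ.>-nonZero⁻¹ order ⦃ proj₁ connected ⦄)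

        -- In K₁ no vertex has a first neighbour and `AllPass` holds vacuously; the first conjunct
        -- covers this case.
        Criterion : Set
        Criterion = (order ≡ 1 → first-vertex ∈ˢ X) × AllPass

        criterion? : Dec Criterion
        criterion? = (order ℕ.≟ 1 →-dec first-vertex ∈? X) ×-dec allPass?

        neighbour : order ≢ 1 → ∀ w → ∃[ v ] w ~ v
        neighbour order≢1 w with other-element order≢1 w
        ... | v , w≢v with proj₁ (proj₂ connected w v)
        ...   | [ _ ]   = contradiction refl w≢v
        ...   | w~x ∷ _ = _ , w~x

        module _ (block : BlockGraph G) where

          strong⇒passes : StrongGeodetic G X → AllPass
          strong⇒passes strong = All.universal (λ u → All.tabulate λ {w} w∈ _ → member-or-escapes u w w∈) _
            where
            member-or-escapes : ∀ u w → w ∈ neighbours u → w ∈ˢ X ⊎ Escapes u w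
            member-or-escapes u w w∈ with w ∈? X
            ... | yes w∈X = inj₁ w∈X
            ... | no w∉X  = inj₂ (branching⇒escapes block (~-sym (Equivalence.to adjacent w∈)) (strong⇒branching strong w∉X))

          strong⇒criterion : StrongGeodetic G X → Criterion
          strong⇒criterion strong = single , strong⇒passes strong
            where
            single : order ≡ 1 → first-vertex ∈ˢ X
            single order≡1 = decidable-stable (first-vertex ∈? X) λ v∉X →
              let _ , _ , v~x , _ = strong⇒branching strong v∉X in
              ~-irrefl (single-element order≡1 _ _) v~x

          criterion⇒strong : Criterion → StrongGeodetic G X
          criterion⇒strong (single , passes) = branching⇒strong block branching connected
            where
            branching : ∀ w → w ∉ˢ X → Branching w
            branching w w∉X with order ℕ.≟ 1
            ... | yes order≡1 = contradiction
                    (subst (_∈ˢ X) (single-element order≡1 _ _) (single order≡1)) w∉X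
            -- With a second vertex present, connectivity gives `w` a neighbour; its list thus has a
            -- head `u`, at which `w` was tested.
            ... | no order≢1 with neighbours w in eq | neighbour order≢1 w
            ...   | []    | v , w~v = case subst (v ∈_) eq (Equivalence.from adjacent w~v) of λ ()
            ...   | u ∷ _ | _ =
              let w~u = Equivalence.to adjacent (subst (u ∈_) (sym eq) (here refl)) in
              case All.lookup (All.lookup passes (∈-allFin u)) (Equivalence.from adjacent (~-sym w~u))
                     (cong List.head eq) of λ where
                (inj₁ w∈X)     → contradiction w∈X w∉X
                (inj₂ escapes) → escapes⇒branching w~u escapes

-- Total correctness with time bounds: rules for program runs.

Runs : Program → Store → ℕ → (Store → Set) → Set
Runs P s bound Q = ∃[ t ] ∃[ s′ ] ⟨ P , s ⟩⇓[ t ] s′ × t ≤ bound × Q s′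

private variable
  P P′ : Program
  s : Store
  Q R : Store → Set
  k l m : ℕ

weaken : k ≤ l → Runs P s k Q → Runs P s l Q
weaken k≤l (t , s′ , run , t≤k , q) = t , s′ , run , ℕ.≤-trans t≤k k≤l , q

run-skip : Q s → Runs skip s 1 Q
run-skip q = _ , _ , skip , ℕ.≤-refl , q

run-assign : ∀ {x e} → Q (setRegister x (eval s e) s) → Runs (x ≔ e) s (suc (costᴱ e)) Q
run-assign q = _ , _ , assign , ℕ.≤-refl , q

run-assignArray : ∀ {x e f} → Q (setArray x (eval s e) (eval s f) s) →
  Runs (x ⟦ e ⟧≔ f) s (suc (costᴱ e + costᴱ f)) Q
run-assignArray q = _ , _ , assignArray , ℕ.≤-refl , q

run-seq : Runs P s k R → (∀ {s′} → R s′ → Runs P′ s′ l Q) → Runs (P ⨾ P′) s (k + l) Q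
run-seq (_ , _ , run , t≤k , r) next with next r
... | _ , _ , run′ , t′≤l , q = _ , _ , seq run run′ , ℕ.+-mono-≤ t≤k t′≤l , q

run-assign-then : ∀ {x e} → Runs P (setRegister x (eval s e) s) k Q →
  Runs (x ≔ e ⨾ P) s (suc (costᴱ e) + k) Q
run-assign-then {e = e} (_ , _ , run , t≤k , q) =
  _ , _ , seq assign run , ℕ.+-monoʳ-≤ (suc (costᴱ e)) t≤k , q

-- The Boolean `c` allows the outcome of a mathematical decision to stand in for the machine test.
run-if : ∀ {b} c → test s b ≡ c → Runs (if c then P else P′) s k Q →
  Runs (if b then P else′ P′) s (suc (costᵀ b + k)) Q
run-if {b = b} true  eq (_ , _ , run , t≤k , q) =
  _ , _ , ifTrue eq run , s≤s (ℕ.+-monoʳ-≤ (costᵀ b) t≤k) , q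
run-if {b = b} false eq (_ , _ , run , t≤k , q) =
  _ , _ , ifFalse eq run , s≤s (ℕ.+-monoʳ-≤ (costᵀ b) t≤k) , q

for : ℕ → Expr → Program → Program
for x e P = while reg x ≺ e loop (P ⨾ x ≔ inc (reg x))

-- The invariant is indexed by the items still to be processed, and the bound `e`, evaluated afresh
-- at each test, must equal the counter plus their number. A round adds `3 + costᴱ e` for the test
-- and 3 for the increment; the failing test at the end costs `3 + costᴱ e` once more.
for-each : ∀ {A : Set} {x e P} (I : List A → Store → Set) (f : A → ℕ) →
  (∀ xs {s} → I xs s → eval s e ≡ register s x + length xs) →
  (∀ a as {s} → I (a ∷ as) s →
    Runs P s (f a) (λ s′ → I as (setRegister x (suc (register s′ x)) s′))) →
  ∀ xs {s} → I xs s →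
  Runs (for x e P) s (∑ xs (λ a → f a + (6 + costᴱ e)) + (3 + costᴱ e)) (I [])
for-each {x = x} {e} I f bound body [] {s} i = _ , _ , whileFalse stop , ℕ.≤-refl , i
  where
  stop : test s (reg x ≺ e) ≡ false
  stop rewrite bound [] i | ℕ.+-identityʳ (register s x) =
    dec-false (register s x ℕ.<? register s x) (ℕ.<-irrefl refl)
for-each {x = x} {e} I f bound body (a ∷ as) {s} i with body a as i
... | t , s₁ , run , t≤fa , i₁ with for-each I f bound body as i₁
...   | t′ , s₂ , run′ , t′≤ , i₂ = _ , s₂ , whileTrue go (seq run assign) run′ , cost , i₂
  where
  go : test s (reg x ≺ e) ≡ true
  go rewrite bound (a ∷ as) i =
    dec-true (register s x ℕ.<? register s x + suc (length as)) (ℕ.m<m+n _ (s≤s z≤n))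

  c rest : ℕ
  c = costᴱ e
  rest = ∑ as (λ a → f a + (6 + c)) + (3 + c)

  cost : suc (suc (1 + c) + (t + 3) + t′) ≤ f a + (6 + c) + ∑ as (λ a → f a + (6 + c)) + (3 + c)
  cost = begin
    suc (suc (1 + c) + (t + 3) + t′)          ≤⟨ s≤s (ℕ.+-mono-≤ (ℕ.+-monoʳ-≤ (2 + c) (ℕ.+-monoˡ-≤ 3 t≤fa)) t′≤) ⟩
    suc (suc (1 + c) + (f a + 3) + rest)      ≡⟨ reorder c (f a) rest ⟩
    f a + (6 + c) + rest                      ≡⟨ ℕ.+-assoc (f a + (6 + c)) _ (3 + c) ⟨
    f a + (6 + c) + ∑ as (λ a → f a + (6 + c)) + (3 + c) ∎
    where
    open ℕ.≤-Reasoning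
    reorder : ∀ c a r → suc (suc (1 + c) + (a + 3) + r) ≡ a + (6 + c) + r
    reorder = solve-∀

[↦]-updates : ∀ (f : ℕ → A) i a → (f [ i ↦ a ]) i ≡ a
[↦]-updates f i a with i ℕ.≡ᵇ i | dec-true (i ℕ.≟ i) refl
... | true | _ = refl

[↦]-minimal : ∀ (f : ℕ → A) {i j} a → i ≢ j → (f [ i ↦ a ]) j ≡ f j
[↦]-minimal f {i} {j} a i≢j with i ℕ.≡ᵇ j | dec-false (i ℕ.≟ j) i≢j
... | false | _ = refl

bit : Bool → ℕ
bit b = if b then 1 else 0

bit-does : ∀ {P : Set} (P? : Dec P) {k} → k ≡ bit (does P?) → k ≡ 1 × P ⊎ k ≡ 0 × ¬ P
bit-does (yes p) k≡ = inj₁ (k≡ , p)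
bit-does (no ¬p) k≡ = inj₂ (k≡ , ¬p)

-- Array 3 stamps N[u] with u + 1, so it need not be cleared between vertices u.
-- Register 1 holds u, register 3 a neighbour w of u, registers 2 and 6 positions
-- in the lists of u and w; registers 4 and 5 are the verdicts on w and on X.
-- The only connected graph with an empty adjacency list is K₁, treated apart.
examine visit mark solve : Program
examine =
  4 ≔ 2 ⟦ reg 3 ⟧ ⨾
  6 ≔ 0 ⟦ reg 3 ⟧ ⨾
  for 6 (0 ⟦ inc (reg 3) ⟧) (if 3 ⟦ 1 ⟦ reg 6 ⟧ ⟧ ≐ inc (reg 1) then skip else′ (4 ≔ lit 1)) ⨾
  (if reg 4 ≐ lit 0 then (5 ≔ lit 0) else′ skip)
visit =
  3 ≔ 1 ⟦ reg 2 ⟧ ⨾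
  (if 1 ⟦ 0 ⟦ reg 3 ⟧ ⟧ ≐ reg 1 then examine else′ skip)
mark =
  3 ⟦ reg 1 ⟧≔ inc (reg 1) ⨾
  2 ≔ 0 ⟦ reg 1 ⟧ ⨾
  for 2 (0 ⟦ inc (reg 1) ⟧) (3 ⟦ 1 ⟦ reg 2 ⟧ ⟧≔ inc (reg 1))
solve =
  (if reg 0 ≐ lit 1 then (5 ≔ 2 ⟦ lit 0 ⟧) else′ (5 ≔ lit 1)) ⨾
  for 1 (reg 0) (mark ⨾ 2 ≔ 0 ⟦ reg 1 ⟧ ⨾ for 2 (0 ⟦ inc (reg 1) ⟧) visit) ⨾
  0 ≔ reg 5

-- Loop invariants and running time of the program.

Segment : ∀ {n} → (ℕ → ℕ) → ℕ → List (Fin n) → Set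
Segment a p []       = ⊤
Segment a p (x ∷ xs) = a p ≡ toℕ x × Segment a (suc p) xs

module _ {G : Graph} (A : AdjacencyLists G) (X : Subset (Graph.order G))
  (connected : Connected G) (off adj mem : ℕ → ℕ)
  (off-suc : ∀ u → off (suc (toℕ u)) ≡ off (toℕ u) + length (AdjacencyLists.neighbours A u))
  (row : ∀ u → Segment adj (off (toℕ u)) (AdjacencyLists.neighbours A u))
  (member : ∀ u → mem (toℕ u) ≡ bit (does (u ∈? X)))
  where
  open Graph G
  open AdjacencyLists A

  Loaded : Store → Set
  Loaded s = array s 0 ≡ off × array s 1 ≡ adj × array s 2 ≡ mem × register s 0 ≡ order

  At : V → Store → Set
  At u s = Loaded s × register s 1 ≡ toℕ u

  -- The second part says that exactly N[u] carries the current stamp; the upper bound makes the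
  -- stamp of the next vertex fresh.
  Stamped : V → Store → Set
  Stamped u s =
    (∀ (x : V) → array s 3 (toℕ x) ≤ suc (toℕ u)) ×
    (∀ x → (array s 3 (toℕ x) ℕ.≡ᵇ suc (toℕ u)) ≡ does (close? {G} u x))

  Remaining : V → ℕ → List V → Set
  Remaining u p ws = Segment adj p ws × off (suc (toℕ u)) ≡ p + length ws

  row-remaining : ∀ u → Remaining u (off (toℕ u)) (neighbours u)
  row-remaining u = row u , off-suc u

  remaining-tail : ∀ u p w ws → Remaining u p (w ∷ ws) → Remaining u (suc p) ws
  remaining-tail u p w ws ((_ , seg) , len) = seg , trans len (ℕ.+-suc p (length ws))

  -- The final verdict `goal` is fixed in advance: the verdict so far, combined with that on the
  -- pending entries, always yields it. The parameters `p` and `b` record what the scan must leave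
  -- intact for the enclosing loop.
  Scanning : V → V → ℕ → Bool → Bool → List V → Store → Set
  Scanning u w p b goal xs s =
    At u s × Stamped u s × register s 2 ≡ p × register s 3 ≡ toℕ w × register s 5 ≡ bit b ×
    Remaining w (register s 6) xs ×
    ∃[ c ] register s 4 ≡ bit c × c ∨ does (Any.any? (λ x → ¬? (close? {G} u x)) xs) ≡ goal

  scan-bound : ∀ {u w p b goal} xs {s} → Scanning u w p b goal xs s →
    eval s (0 ⟦ inc (reg 3) ⟧) ≡ register s 6 + length xs
  scan-bound xs (((off≡ , _) , _) , _ , _ , r₃ , _ , (_ , len) , _) rewrite off≡ | r₃ = len

  scan-step : ∀ {u w p b goal} x xs {s} → Scanning u w p b goal (x ∷ xs) s →
    Runs (if 3 ⟦ 1 ⟦ reg 6 ⟧ ⟧ ≐ inc (reg 1) then skip else′ (4 ≔ lit 1)) s 9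
      (λ s′ → Scanning u w p b goal xs (setRegister 6 (suc (register s′ 6)) s′))
  scan-step {u} {w} {p} {b} {goal} x xs {s}
    (at@((_ , adj≡ , _) , r₁) , st@(_ , stamped) , r₂ , r₃ , r₅ , rem@((adj-x , _) , _) , c , r₄ , eq) =
    run-if (does (close? {G} u x)) test≡ (branch (does (close? {G} u x)) eq)
    where
    test≡ : (array s 3 (array s 1 (register s 6)) ℕ.≡ᵇ suc (register s 1)) ≡ does (close? {G} u x)
    test≡ rewrite adj≡ | adj-x | r₁ = stamped x

    found : Bool
    found = does (Any.any? (λ x → ¬? (close? {G} u x)) xs)

    branch : ∀ d → c ∨ (not d ∨ found) ≡ goal →
      Runs (if d then skip else (4 ≔ lit 1)) s 2
        (λ s′ → Scanning u w p b goal xs (setRegister 6 (suc (register s′ 6)) s′))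
    branch true  eq = weaken (s≤s z≤n) (run-skip
      (at , st , r₂ , r₃ , r₅ , remaining-tail w _ x xs rem , c , r₄ , eq))
    branch false eq = run-assign
      (at , st , r₂ , r₃ , r₅ , remaining-tail w _ x xs rem , true , refl , trans (sym (∨-zeroʳ c)) eq)

  examine-runs : ∀ {u w p b s} →
    At u s → Stamped u s → register s 2 ≡ p → register s 3 ≡ toℕ w → register s 5 ≡ bit b →
    Runs examine s (18 + 18 * length (neighbours w)) (λ s′ →
      At u s′ × Stamped u s′ × register s′ 2 ≡ p ×
      register s′ 5 ≡ bit (b ∧ (does (w ∈? X) ∨ does (escapes? A u w))))
  examine-runs {u} {w} {p} {b} {s} at@((off≡ , _ , mem≡ , _) , _) st r₂ r₃ r₅ =
    weaken (ℕ.≤-reflexive cost)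
      (run-assign-then (run-assign-then (run-seq
        (for-each (Scanning u w p b goal) (λ _ → 9) scan-bound scan-step (neighbours w) start) finish)))
    where
    goal : Bool
    goal = does (w ∈? X) ∨ does (escapes? A u w)

    s₁ : Store
    s₁ = setRegister 6 (array s 0 (register s 3)) (setRegister 4 (array s 2 (register s 3)) s)

    start : Scanning u w p b goal (neighbours w) s₁
    -- The verdict on `w` starts as its membership in `X`, so a member passes whatever the scan
    -- finds.
    start = at , st , r₂ , r₃ , r₅ ,
      subst (λ q → Remaining w q (neighbours w)) (sym (cong₂ (λ f → f) off≡ r₃)) (row-remaining w) ,
      does (w ∈? X) , trans (cong₂ (λ f → f) mem≡ r₃) (member w) , refl

    finish : ∀ {s′} → Scanning u w p b goal [] s′ →
      Runs (if reg 4 ≐ lit 0 then (5 ≔ lit 0) else′ skip) s′ 6 (λ s′ →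
        At u s′ × Stamped u s′ × register s′ 2 ≡ p × register s′ 5 ≡ bit (b ∧ goal))
    finish (at , st , r₂ , _ , r₅ , _ , true , r₄ , eq) = run-if false (cong (ℕ._≡ᵇ 0) r₄)
      (weaken (s≤s z≤n) (run-skip (at , st , r₂ ,
        trans r₅ (cong bit (trans (sym (∧-identityʳ b)) (cong (b ∧_) eq))))))
    finish (at , st , r₂ , _ , r₅ , _ , false , r₄ , eq) = run-if true (cong (ℕ._≡ᵇ 0) r₄)
      (run-assign (at , st , r₂ ,
        cong bit (trans (sym (∧-zeroʳ b)) (cong (b ∧_) eq))))

    cost : 3 + (3 + ((∑ (neighbours w) (λ _ → 18) + 6) + 6)) ≡ 18 + 18 * length (neighbours w)
    cost rewrite ∑-const 18 (neighbours w) = arith (length (neighbours w))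
      where
      arith : ∀ d → 3 + (3 + ((d * 18 + 6) + 6)) ≡ 18 + 18 * d
      arith = solve-∀

  -- Only the part of the cost that grows with the degree of `w`, for use with `∑-first≤`; the
  -- constant part of `examine` is contained in the 27 of `visit-step`.
  charge : V → V → ℕ
  charge u w = if does (first? A u w) then 18 * length (neighbours w) else 0

  -- The edge guarantees that the list of `w` is non-empty, so the cell read really holds its head.
  first-test : ∀ {u w} → u ~ w → (adj (off (toℕ w)) ℕ.≡ᵇ toℕ u) ≡ does (first? A u w)
  first-test {u} {w} u~w with neighbours w | row w | Equivalence.from adjacent (~-sym u~w)
  ... | x ∷ _ | adj≡x , _ | _ rewrite adj≡x = does-⇔
    (mk⇔ (cong just ∘ Fin.toℕ-injective) (cong toℕ ∘ just-injective))
    (toℕ x ℕ.≟ toℕ u) (Maybe.≡-dec Fin._≟_ (just x) (just u))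

  -- Here `rest` is the verdict on the vertices after `u`, which lets `goal` be the verdict of the
  -- whole outer loop.
  Visiting : V → Bool → Bool → List V → Store → Set
  Visiting u rest goal ws s =
    At u s × Stamped u s × Remaining u (register s 2) ws × All (u ~_) ws ×
    ∃[ b ] register s 5 ≡ bit b × b ∧ (does (All.all? (passes? A X u) ws) ∧ rest) ≡ goal

  remaining-bound : ∀ {u s} ws → At u s → Remaining u (register s 2) ws →
    eval s (0 ⟦ inc (reg 1) ⟧) ≡ register s 2 + length ws
  remaining-bound ws ((off≡ , _) , r₁) (_ , len) rewrite off≡ | r₁ = len

  visit-step : ∀ {u rest goal} w ws {s} → Visiting u rest goal (w ∷ ws) s →
    Runs visit s (27 + charge u w)
      (λ s′ → Visiting u rest goal ws (setRegister 2 (suc (register s′ 2)) s′))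
  visit-step {u} {rest} {goal} w ws {s}
    (at@((off≡ , adj≡ , _) , r₁) , st , rem@((adj-w , _) , _) , u~w ∷ u~ws , b , r₅ , eq) =
    weaken (cost (does (first? A u w)))
      (run-assign-then (run-if (does (first? A u w)) test≡ (branch (does (first? A u w))
        (trans (cong (b ∧_) (sym (∧-assoc (does (passes? A X u w)) _ rest))) eq))))
    where
    r₃ : array s 1 (register s 2) ≡ toℕ w
    r₃ = trans (cong (λ f → f (register s 2)) adj≡) adj-w

    s₁ : Store
    s₁ = setRegister 3 (array s 1 (register s 2)) s

    test≡ : test s₁ (1 ⟦ 0 ⟦ reg 3 ⟧ ⟧ ≐ reg 1) ≡ does (first? A u w)
    test≡ = trans (cong₂ ℕ._≡ᵇ_ (cong₂ id adj≡ (cong₂ id off≡ r₃)) r₁) (first-test u~w)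

    passed : Bool
    passed = does (w ∈? X) ∨ does (escapes? A u w)

    others : Bool
    others = does (All.all? (passes? A X u) ws) ∧ rest

    branchCost : Bool → ℕ
    branchCost d = if d then 18 + 18 * length (neighbours w) else 1

    next : ∀ {s′} b′ → At u s′ → Stamped u s′ → register s′ 2 ≡ register s 2 →
      register s′ 5 ≡ bit b′ → b′ ∧ others ≡ goal →
      Visiting u rest goal ws (setRegister 2 (suc (register s′ 2)) s′)
    next b′ at st r₂ r₅ eq = at , st ,
      subst (λ p → Remaining u p ws) (cong suc (sym r₂)) (remaining-tail u _ w ws rem) ,
      u~ws , b′ , r₅ , eq

    branch : ∀ d → b ∧ ((not d ∨ passed) ∧ others) ≡ goal →
      Runs (if d then examine else skip) s₁ (branchCost d)
        (λ s′ → Visiting u rest goal ws (setRegister 2 (suc (register s′ 2)) s′))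
    branch true eq with examine-runs {w = w} {b = b} {s = s₁} at st refl r₃ r₅
    ... | t , s′ , run , t≤ , at , st , r₂ , r₅ =
      t , s′ , run , t≤ , next {s′} (b ∧ passed) at st r₂ r₅ (trans (∧-assoc b passed others) eq)
    branch false eq = run-skip (next {s₁} b at st refl r₅ eq)

    cost : ∀ d → 3 + suc (5 + branchCost d) ≤ 27 + (if d then 18 * length (neighbours w) else 0)
    cost true  = ℕ.≤-refl
    cost false = ℕ.m≤m+n 10 17

  Marking : V → Bool → List V → Store → Set
  Marking u b ws s =
    At u s × register s 5 ≡ bit b × Remaining u (register s 2) ws ×
    (∀ (x : V) → array s 3 (toℕ x) ≤ suc (toℕ u)) ×
    (∀ x → (array s 3 (toℕ x) ℕ.≡ᵇ suc (toℕ u)) ∨ does (Any.any? (x Fin.≟_) ws) ≡ does (close? {G} u x))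

  stamp-≤ : ∀ (a : ℕ → ℕ) i {k l} → l ≤ k → ∀ j → a j ≤ k → (a [ i ↦ l ]) j ≤ k
  stamp-≤ a i {k} {l} l≤k j aj≤k with i ℕ.≟ j
  ... | yes refl = subst (_≤ k) (sym ([↦]-updates a i l)) l≤k
  ... | no i≢j   = subst (_≤ k) (sym ([↦]-minimal a l i≢j)) aj≤k

  -- Writing a stamp moves `y` from the pending vertices to the stamped ones and leaves their union
  -- unchanged. This serves both for `u` itself and for its neighbours.
  stamp-∨ : ∀ (a : ℕ → ℕ) i {k l} (x y : V) (c : Bool) → i ≡ toℕ y → l ≡ k →
    ((a [ i ↦ l ]) (toℕ x) ℕ.≡ᵇ k) ∨ c ≡ (a (toℕ x) ℕ.≡ᵇ k) ∨ (does (x Fin.≟ y) ∨ c)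
  stamp-∨ a _ {k} x y c refl refl with x Fin.≟ y
  ... | yes refl = trans
    (cong (_∨ c) (trans (cong (ℕ._≡ᵇ k) ([↦]-updates a (toℕ x) k)) (dec-true (k ℕ.≟ k) refl)))
    (sym (∨-zeroʳ _))
  ... | no x≢y = cong (λ n → (n ℕ.≡ᵇ k) ∨ c)
    ([↦]-minimal a k (x≢y ∘ sym ∘ Fin.toℕ-injective))

  mark-step : ∀ {u b} w ws {s} → Marking u b (w ∷ ws) s →
    Runs (3 ⟦ 1 ⟦ reg 2 ⟧ ⟧≔ inc (reg 1)) s 5
      (λ s′ → Marking u b ws (setRegister 2 (suc (register s′ 2)) s′))
  mark-step {u} {b} w ws {s}
    (at@((_ , adj≡ , _) , r₁) , r₅ , rem@((adj-w , _) , _) , recent , stamped) = run-assignArray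
    (at , r₅ , remaining-tail u _ w ws rem ,
      (λ x → stamp-≤ (array s 3) (array s 1 (register s 2)) (ℕ.≤-reflexive (cong suc r₁)) (toℕ x) (recent x)) ,
      λ x → trans (stamp-∨ (array s 3) _ x w _ w≡ (cong suc r₁)) (stamped x))
    where
    w≡ : array s 1 (register s 2) ≡ toℕ w
    w≡ = trans (cong (λ f → f (register s 2)) adj≡) adj-w

  mark-runs : ∀ {u b s} → At u s → register s 5 ≡ bit b → (∀ (x : V) → array s 3 (toℕ x) ≤ toℕ u) →
    Runs mark s (13 + 14 * length (neighbours u))
      (λ s′ → At u s′ × Stamped u s′ × register s′ 5 ≡ bit b)
  mark-runs {u} {b} {s} at@((off≡ , _) , r₁) r₅ old = weaken (ℕ.≤-reflexive cost)
    (run-seq {R = _≡ s₀} (run-assignArray refl) λ { refl →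
      run-assign-then (finish
        (for-each (Marking u b) (λ _ → 5) (λ { ws {s} (at , _ , rem , _) → remaining-bound {s = s} ws at rem })
          mark-step (neighbours u) start)) })
    where
    s₀ s₁ : Store
    s₀ = setArray 3 (register s 1) (suc (register s 1)) s
    s₁ = setRegister 2 (array s 0 (register s 1)) s₀

    finish : ∀ {P s k} → Runs P s k (Marking u b []) →
      Runs P s k (λ s′ → At u s′ × Stamped u s′ × register s′ 5 ≡ bit b)
    finish (t , s′ , run , t≤ , at , r₅ , _ , recent , stamped) =
      t , s′ , run , t≤ , at , (recent , λ x → trans (sym (∨-identityʳ _)) (stamped x)) , r₅

    closed-neighbourhood : ∀ x → (array s 3 (toℕ x) ℕ.≡ᵇ suc (toℕ u)) ∨
      (does (x Fin.≟ u) ∨ does (Any.any? (x Fin.≟_) (neighbours u))) ≡ does (close? {G} u x)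
    -- Stamps left by earlier vertices are at most `toℕ u`, so none is mistaken for the current one.
    closed-neighbourhood x
      rewrite dec-false (array s 3 (toℕ x) ℕ.≟ suc (toℕ u)) (ℕ.<⇒≢ (s≤s (old x))) =
      does-⇔ (mk⇔ (Sum.map sym (Equivalence.to adjacent)) (Sum.map sym (Equivalence.from adjacent)))
        (x Fin.≟ u ⊎-dec Any.any? (x Fin.≟_) (neighbours u)) (close? {G} u x)

    start : Marking u b (neighbours u) s₁
    start = at , r₅ ,
      subst (λ p → Remaining u p (neighbours u)) (sym (cong₂ id off≡ r₁)) (row-remaining u) ,
      (λ x → stamp-≤ (array s 3) (register s 1) (ℕ.≤-reflexive (cong suc r₁)) (toℕ x) (ℕ.m≤n⇒m≤1+n (old x))) ,
      λ x → trans (stamp-∨ (array s 3) _ x u _ r₁ (cong suc r₁)) (closed-neighbourhood x)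

    cost : 4 + (3 + (∑ (neighbours u) (λ _ → 14) + 6)) ≡ 13 + 14 * length (neighbours u)
    cost rewrite ∑-const 14 (neighbours u) = arith (length (neighbours u))
      where
      arith : ∀ d → 4 + (3 + (d * 14 + 6)) ≡ 13 + 14 * d
      arith = solve-∀

  -- With `id` as the array, `Segment` says that the pending vertices are numbered consecutively
  -- from register 1 upward.
  Deciding : Bool → List V → Store → Set
  Deciding goal us s =
    Loaded s × Segment id (register s 1) us × order ≡ register s 1 + length us ×
    (∀ (x : V) → array s 3 (toℕ x) ≤ register s 1) ×
    ∃[ b ] register s 5 ≡ bit b ×
      b ∧ does (All.all? (λ u → All.all? (passes? A X u) (neighbours u)) us) ≡ goal

  -- Per neighbour, marking takes 14 and visiting 36, loop control included; examinations are
  -- accounted for by `charge`.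
  vertexCost : V → ℕ
  vertexCost u = 22 + 50 * length (neighbours u) + ∑ (neighbours u) (charge u)

  vertex-step : ∀ {goal} u us {s} → Deciding goal (u ∷ us) s →
    Runs (mark ⨾ 2 ≔ 0 ⟦ reg 1 ⟧ ⨾ for 2 (0 ⟦ inc (reg 1) ⟧) visit) s (vertexCost u)
      (λ s′ → Deciding goal us (setRegister 1 (suc (register s′ 1)) s′))
  vertex-step {goal} u us {s} (loaded , (r₁ , seg) , len , old , b , r₅ , eq) =
    weaken (ℕ.≤-reflexive cost)
      (run-seq (mark-runs {b = b} {s = s} (loaded , r₁) r₅ (λ x → subst (array s 3 (toℕ x) ≤_) r₁ (old x)))
        λ {s′} (at , st , r₅) → run-assign-then (finish
          (for-each (Visiting u rest goal) (λ w → 27 + charge u w)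
            (λ { ws {s} (at , _ , rem , _) → remaining-bound {s = s} ws at rem })
            visit-step (neighbours u)
            (at , st , start {s′} at , All.tabulate (Equivalence.to adjacent) , b , r₅ , eq))))
    where
    rest : Bool
    rest = does (All.all? (λ u → All.all? (passes? A X u) (neighbours u)) us)

    start : ∀ {s′} → At u s′ → Remaining u (array s′ 0 (register s′ 1)) (neighbours u)
    start ((off≡ , _) , r₁) = subst (λ p → Remaining u p (neighbours u)) (sym (cong₂ id off≡ r₁)) (row-remaining u)

    finish : ∀ {P s k} → Runs P s k (Visiting u rest goal []) →
      Runs P s k (λ s′ → Deciding goal us (setRegister 1 (suc (register s′ 1)) s′))
    finish (t , s′ , run , t≤ , (loaded , r₁′) , (recent , _) , _ , _ , b , r₅ , eq) =
      t , s′ , run , t≤ , loaded , subst (λ p → Segment id (suc p) us) r₁≡ seg ,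
      trans len (trans (ℕ.+-suc (register s 1) (length us)) (cong (λ p → suc p + length us) r₁≡)) ,
      (λ x → subst (λ p → array s′ 3 (toℕ x) ≤ suc p) (sym r₁′) (recent x)) , b , r₅ , eq
      where
      r₁≡ : register s 1 ≡ register s′ 1
      r₁≡ = trans r₁ (sym r₁′)

    d : ℕ
    d = length (neighbours u)

    visits : ∑ (neighbours u) (λ w → 27 + charge u w + 9) ≡ d * 36 + ∑ (neighbours u) (charge u)
    visits = trans (cong sum (List.map-cong (λ w → arith (charge u w)) (neighbours u)))
      (trans (∑-+ (λ _ → 36) (charge u) (neighbours u)) (cong (_+ ∑ (neighbours u) (charge u)) (∑-const 36 (neighbours u))))
      where
      arith : ∀ c → 27 + c + 9 ≡ 36 + c
      arith = solve-∀

    cost : 13 + 14 * d + (3 + (∑ (neighbours u) (λ w → 27 + charge u w + 9) + 6)) ≡ vertexCost u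
    cost rewrite visits = arith d (∑ (neighbours u) (charge u))
      where
      arith : ∀ d h → 13 + 14 * d + (3 + (d * 36 + h + 6)) ≡ 22 + 50 * d + h
      arith = solve-∀

  -- The verdict with which register 5 enters the outer loop.
  single : Bool
  single = does (order ℕ.≟ 1 →-dec first-vertex A X connected ∈? X)

  all-vertices : ∀ {n} m (f : Fin n → V) → (∀ i → toℕ (f i) ≡ m + toℕ i) →
    Segment id m (List.tabulate f)
  all-vertices {zero}  m f eq = tt
  all-vertices {suc n} m f eq = sym (trans (eq Fin.zero) (ℕ.+-identityʳ m)) ,
    all-vertices (suc m) (f ∘ Fin.suc) λ i → trans (eq (Fin.suc i)) (ℕ.+-suc m (toℕ i))

  solve-runs : BlockGraph G → ∀ {s} → Loaded s → register s 1 ≡ 0 → (∀ x → array s 3 x ≡ 0) →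
    solve Decides StrongGeodetic G X From s Within (138 * (order + size))
  solve-runs block {s} loaded@(_ , _ , mem≡ , r₀) r₁ blank =
    let t , s′ , run , t≤ , r₀≡ = run in t , s′ , run , ℕ.≤-trans t≤ cost , verdict r₀≡
    where
    goal : Bool
    goal = does (criterion? A X connected)

    initially : ∀ b {r} → b ≡ single → r ≡ bit b → Deciding goal (allFin order) (setRegister 5 r s)
    initially b b≡ r≡ = loaded ,
      subst (λ p → Segment id p (allFin order)) (sym r₁) (all-vertices 0 id (λ _ → refl)) ,
      sym (cong₂ _+_ r₁ (List.length-tabulate id)) ,
      (λ x → ℕ.≤-trans (ℕ.≤-reflexive (blank (toℕ x))) z≤n) , b , r≡ ,
      cong (_∧ does (allPass? A X)) b≡

    first : Runs (if reg 0 ≐ lit 1 then (5 ≔ 2 ⟦ lit 0 ⟧) else′ (5 ≔ lit 1)) s 7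
      (Deciding goal (allFin order))
    first = run-if (does (order ℕ.≟ 1)) (cong (ℕ._≡ᵇ 1) r₀) (branch (does (order ℕ.≟ 1)) refl)
      where
      v : V
      v = first-vertex A X connected
      member₀ : array s 2 0 ≡ bit (does (v ∈? X))
      member₀ = trans (cong₂ id mem≡ (sym (Fin.toℕ-fromℕ< _))) (member v)
      branch : ∀ c → c ≡ does (order ℕ.≟ 1) → Runs (if c then (5 ≔ 2 ⟦ lit 0 ⟧) else (5 ≔ lit 1)) s 3 (Deciding goal (allFin order))
      branch true  eq = run-assign (initially (does (v ∈? X)) (cong (λ c → not c ∨ does (v ∈? X)) eq) member₀)
      branch false eq = weaken (s≤s (s≤s z≤n))
        (run-assign (initially true (cong (λ c → not c ∨ does (v ∈? X)) eq) refl))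

    run : Runs solve s (7 + ((∑ (allFin order) (λ u → vertexCost u + 7) + 4) + 2)) (λ s′ → register s′ 0 ≡ bit goal)
    run = run-seq first λ deciding → run-seq
      (for-each (Deciding goal) vertexCost (λ { us ((_ , _ , _ , r₀) , _ , len , _) → trans r₀ len })
        vertex-step (allFin order) deciding)
      λ { (_ , _ , _ , _ , b , r₅ , eq) → run-assign (trans r₅ (cong bit (trans (sym (∧-identityʳ b)) eq))) }

    verdict : ∀ {r} → r ≡ bit goal → r ≡ 1 × StrongGeodetic G X ⊎ r ≡ 0 × ¬ StrongGeodetic G X
    verdict r≡ = Sum.map
      (λ (r≡1 , c) → r≡1 , criterion⇒strong A X connected block c)
      (λ (r≡0 , ¬c) → r≡0 , ¬c ∘ strong⇒criterion A X connected block)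
      (bit-does (criterion? A X connected) r≡)

    degrees : ℕ
    degrees = ∑ (allFin order) (length ∘ neighbours)

    cost : 7 + ((∑ (allFin order) (λ u → vertexCost u + 7) + 4) + 2) ≤ 138 * (order + size)
    cost = begin
      7 + ((∑ vs (λ u → vertexCost u + 7) + 4) + 2)    ≡⟨ cong (λ c → 7 + ((c + 4) + 2)) total ⟩
      7 + ((order * 29 + 50 * degrees + charges + 4) + 2) ≤⟨ ℕ.+-monoʳ-≤ 7 (ℕ.+-monoˡ-≤ 2 (ℕ.+-monoˡ-≤ 4 (ℕ.+-monoʳ-≤ (order * 29 + 50 * degrees) charges≤))) ⟩
      7 + ((order * 29 + 50 * degrees + 18 * degrees + 4) + 2) ≡⟨ arith₁ order degrees ⟩
      -- The constant is written `13 * 1` so that `1 ≤ order` absorbs it.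
      13 * 1 + 29 * order + 68 * degrees               ≤⟨ ℕ.+-mono-≤ (ℕ.+-monoˡ-≤ (29 * order) (ℕ.*-monoʳ-≤ 13 (ℕ.>-nonZero⁻¹ order ⦃ proj₁ connected ⦄))) (ℕ.*-monoʳ-≤ 68 (handshake A)) ⟩
      -- The added slack raises both coefficients, 42 and 136, to the common 138.
      13 * order + 29 * order + 68 * (size + size)     ≤⟨ ℕ.m≤m+n _ (96 * order + 2 * size) ⟩
      13 * order + 29 * order + 68 * (size + size) + (96 * order + 2 * size) ≡⟨ arith₂ order size ⟩
      138 * (order + size)                             ∎
      where
      open ℕ.≤-Reasoning
      vs : List V
      vs = allFin order

      charges : ℕ
      charges = ∑ vs (λ u → ∑ (neighbours u) (charge u))

      charges≤ : charges ≤ 18 * degrees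
      charges≤ = ℕ.≤-trans (∑-first≤ A (λ w → 18 * length (neighbours w)))
        (ℕ.≤-reflexive (∑-* 18 (length ∘ neighbours) vs))

      total : ∑ vs (λ u → vertexCost u + 7) ≡ order * 29 + 50 * degrees + charges
      total = trans (cong sum (List.map-cong (λ u → arith₀ (length (neighbours u)) (∑ (neighbours u) (charge u))) vs))
        (trans (∑-+ (λ u → 29 + 50 * length (neighbours u)) _ vs) (cong (_+ charges)
          (trans (∑-+ (λ _ → 29) _ vs) (cong₂ _+_
            (trans (∑-const 29 vs) (cong (_* 29) {y = order} (List.length-tabulate id)))
            (∑-* 50 (length ∘ neighbours) vs)))))
        where
        arith₀ : ∀ d h → 22 + 50 * d + h + 7 ≡ 29 + 50 * d + h
        arith₀ = solve-∀

      arith₁ : ∀ n d → 7 + ((n * 29 + 50 * d + 18 * d + 4) + 2) ≡ 13 * 1 + 29 * n + 68 * d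
      arith₁ = solve-∀

      arith₂ : ∀ n m → 13 * n + 29 * n + 68 * (m + m) + (96 * n + 2 * m) ≡ 138 * (n + m)
      arith₂ = solve-∀

-- Reading the encoded input.

fromList-applyUpTo : ∀ (f g : ℕ → ℕ) {m i} → i < m → fromList (List.map f (List.applyUpTo g m)) i ≡ f (g i)
fromList-applyUpTo f g {suc m} {zero}  _         = refl
fromList-applyUpTo f g {suc m} {suc i} (s≤s i<m) = fromList-applyUpTo f (g ∘ suc) i<m

fromList-toList : ∀ {n} (f : A → ℕ) (xs : Vec.Vec A n) i →
  fromList (List.map f (Vec.toList xs)) (toℕ i) ≡ f (Vec.lookup xs i)
fromList-toList f (x Vec.∷ xs) Fin.zero    = refl
fromList-toList f (x Vec.∷ xs) (Fin.suc i) = fromList-toList f xs i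

lookup-does : ∀ {n} (p : Subset n) i → Vec.lookup p i ≡ does (i ∈? p)
lookup-does (inside  Vec.∷ p) Fin.zero    = refl
lookup-does (outside Vec.∷ p) Fin.zero    = refl
lookup-does (_       Vec.∷ p) (Fin.suc i) = lookup-does p i

-- The moving base `p` lets one induction first skip `xs` and then read off `ys`.
segment-++ : ∀ {n} (a : ℕ → ℕ) p (xs ys zs : List (Fin n)) →
  (∀ i → a (i + p) ≡ fromList (List.map toℕ (xs ++ ys ++ zs)) i) → Segment a (length xs + p) ys
segment-++ a p (x ∷ xs) ys zs eq = subst (λ q → Segment a q ys) (ℕ.+-suc (length xs) p)
  (segment-++ a (suc p) xs ys zs λ i → trans (cong a (ℕ.+-suc i p)) (eq (suc i)))
segment-++ a p []       []       zs eq = tt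
segment-++ a p []       (y ∷ ys) zs eq = eq 0 ,
  segment-++ a (suc p) [] ys zs λ i → trans (cong a (ℕ.+-suc i p)) (eq (suc i))

take-tabulate : ∀ {n} (f : Fin n → List A) i →
  ∃[ rest ] List.concat (List.tabulate f) ≡ List.concat (List.take (toℕ i) (List.tabulate f)) ++ f i ++ rest
take-tabulate f Fin.zero    = _ , refl
take-tabulate f (Fin.suc i) with take-tabulate (f ∘ Fin.suc) i
... | rest , eq = rest , trans (cong (f Fin.zero ++_) eq) (sym (List.++-assoc (f Fin.zero) _ _))

length-take-suc : ∀ {n} (f : Fin n → List A) i →
  length (List.concat (List.take (suc (toℕ i)) (List.tabulate f))) ≡
  length (List.concat (List.take (toℕ i) (List.tabulate f))) + length (f i)
length-take-suc f Fin.zero = cong length (List.++-identityʳ (f Fin.zero))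
length-take-suc f (Fin.suc i) = begin
  length (f Fin.zero ++ _)                                         ≡⟨ List.length-++ (f Fin.zero) ⟩
  length (f Fin.zero) + _                                          ≡⟨ cong (length (f Fin.zero) +_) (length-take-suc (f ∘ Fin.suc) i) ⟩
  length (f Fin.zero) + (length before + length (f (Fin.suc i)))   ≡⟨ ℕ.+-assoc (length (f Fin.zero)) _ _ ⟨
  length (f Fin.zero) + length before + length (f (Fin.suc i))     ≡⟨ cong (_+ length (f (Fin.suc i))) (List.length-++ (f Fin.zero)) ⟨
  length (f Fin.zero ++ before) + length (f (Fin.suc i))           ∎
  where
  open ≡-Reasoning
  before = List.concat (List.take (toℕ i) (List.tabulate (f ∘ Fin.suc)))

corollary11 : Σ[ P ∈ Program ] Σ[ c ∈ ℕ ]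
    ((G : Graph) → Connected G → BlockGraph G →
    (A : AdjacencyLists G) (X : Subset (Graph.order G)) →
    P Decides (StrongGeodetic G X) From (encode G A X)
    Within (c * (Graph.order G + Graph.size G)))
corollary11 = solve , 138 , λ G connected block A X →
  let open Graph G
      open AdjacencyLists A
      s = encode G A X
      offset : ℕ → ℕ
      offset i = length (List.concat (List.take i (List.tabulate neighbours)))

      -- There is one offset more than there are vertices, so the end of the last row can be looked
      -- up as well.
      off≡ : ∀ {i} → i < suc order → array s 0 i ≡ offset i
      off≡ = fromList-applyUpTo offset id

      off≡′ : ∀ u → array s 0 (toℕ u) ≡ offset (toℕ u)
      off≡′ u = off≡ (ℕ.m≤n⇒m≤1+n (Fin.toℕ<n u))
  in solve-runs A X connected (array s 0) (array s 1) (array s 2)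
       (λ u → trans (off≡ (s≤s (Fin.toℕ<n u)))
         (trans (length-take-suc neighbours u) (cong (_+ length (neighbours u)) (sym (off≡′ u)))))
       (λ u → subst (λ p → Segment (array s 1) p (neighbours u))
         (trans (ℕ.+-identityʳ _) (sym (off≡′ u)))
         (let rest , eq = take-tabulate neighbours u in
          segment-++ (array s 1) 0 (List.concat (List.take (toℕ u) (List.tabulate neighbours))) (neighbours u) rest λ i →
            trans (cong (array s 1) (ℕ.+-identityʳ i)) (cong (λ vs → fromList (List.map toℕ vs) i) eq)))
       (λ u → trans (fromList-toList _ X u) (cong bit (lookup-does X u)))
       -- Memory not set by `encode` is 0: register 1 starts at the first vertex, and array 3 bears
       -- no stamp because stamps are positive.
       block (refl , refl , refl , refl) refl (λ _ → refl)
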